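{- For each $n$, let $G_s(\alpha,k)$ be a uniform random temporal star on a star with $n$ vertices, where $\alpha=\alpha(n)$ and $k=k(n)$ satisfy $\alpha\ge 2n$ and $k\ge 6n\ln n$. Then the probability that $G_s(\alpha,k)$ is explorable (all its edges can be explored) tends to $1$ as $n\to\infty$.
   Context: A uniform random temporal star $G_s(\alpha,k)$: take a star $G_s$ with center $c$ and $n-1$ leaves; each edge independently receives $k$ labels, each chosen independently and uniformly at random from $\{1,2,\dots,\alpha\}$ (labels are the discrete times at which the edge is available). A journey is a sequence of time edges $(u,u_1,l_1),(u_1,u_2,l_2),\dots$, each $l_t$ a label of the edge traversed, with strictly increasing labels. The temporal star is explorable if there is a journey starting and ending at $c$ that visits every vertex. -}

module Defs where

open import Data.Nat as ℕ using (ℕ; zero; suc; pred)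
import Data.Nat.Properties as ℕ
open import Data.Fin using (Fin; zero; suc; toℕ)
open import Data.Fin.Properties using (_≟_; any?; all?; toℕ<n)
open import Data.Integer using (+_)
open import Data.List using (List; []; _∷_; length; filter; allFin; cartesianProductWith)
open import Data.List.Membership.Propositional using (_∈_)
open import Data.List.Membership.DecPropositional using (_∈?_)
open import Data.Product using (Σ; ∃-syntax; _×_; _,_)
open import Data.Rational using (ℚ; 0ℚ; _/_; _+_; _-_; _*_; _≤_; _<_; ∣_∣)
open import Data.Vec using (Vec; []; _∷_; lookup)
open import Relation.Binary.PropositionalEquality using (_≡_; refl; subst)
open import Relation.Nullary using (Dec; yes; no)
open import Relation.Unary using (Decidable)

_⟶_ : (ℕ → ℚ) → ℚ → Set
f ⟶ L = ∀ ε → 0ℚ < ε → ∃[ N ] (∀ n → N ℕ.≤ n → ∣ f n - L ∣ < ε)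

fromℕ : ℕ → ℚ
fromℕ n = + n / 1

-- Division by 0 is 0 by convention.
ratio : ℕ → ℕ → ℚ
ratio a zero    = 0ℚ
ratio a (suc b) = + a / suc b

-- Uniform probability of an event on a sample space listed without
-- repetition.
ℙ : ∀ {A : Set} {P : A → Set} → List A → Decidable P → ℚ
ℙ Ω P? = ratio (length (filter P? Ω)) (length Ω)

vectors : ∀ {A : Set} → List A → ∀ m → List (Vec A m)
vectors xs zero    = [] ∷ []
vectors xs (suc m) = cartesianProductWith _∷_ xs (vectors xs m)

-- 1/(a+1) + 1/(a+2) + ⋯ + 1/(a+r)
harmonic : ℕ → ℕ → ℚ
harmonic a zero    = 0ℚ
harmonic a (suc r) = harmonic a r + + 1 / suc (a ℕ.+ r)

-- ln n = ∫₁ⁿ dt/t.  Cutting [1,n] into intervals of length 1/m, the lower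
-- Darboux sum of this integral is
--   Σ_{m < i ≤ nm} (1/m) · 1/(i/m)  =  1/(m+1) + ⋯ + 1/(nm).
-- (For m = 0 the sum is empty.)
lnLowerSum : ℕ → ℕ → ℚ
lnLowerSum n m = harmonic m (n ℕ.* m ℕ.∸ m)

-- The lower cut of the real number ln n (n ≥ 1), the supremum of its lower
-- Darboux sums.
_<ln_ : ℚ → ℕ → Set
q <ln n = ∃[ m ] q < lnLowerSum n m

-- y ≥ c · ln n, for c ≥ 0.
_≥_·ln_ : ℚ → ℚ → ℕ → Set
y ≥ c ·ln n = ∀ q → q <ln n → c * q ≤ y

-- A star with ℓ leaves has vertex set Fin (suc ℓ), with center zero; its
-- edges are indexed by their leaf.
Vertex : ℕ → Set
Vertex ℓ = Fin (suc ℓ)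

center : ∀ {ℓ} → Vertex ℓ
center = zero

leaf : ∀ {ℓ} → Fin ℓ → Vertex ℓ
leaf = suc

Labelling : (ℓ α k : ℕ) → Set
Labelling ℓ α k = Vec (Vec (Fin α) k) ℓ

labellings : ∀ ℓ α k → List (Labelling ℓ α k)
labellings ℓ α k = vectors (vectors (allFin α) k) ℓ

module _ {ℓ α k : ℕ} (G : Labelling ℓ α k) where

  -- The j-th label of edge i, as an element of {1, …, α}.
  label : Fin ℓ → Fin k → ℕ
  label i j = suc (toℕ (lookup (lookup G i) j))

  data TimeEdge : Vertex ℓ → Vertex ℓ → ℕ → Set where
    outward : ∀ i j → TimeEdge center (leaf i) (label i j)
    inward  : ∀ i j → TimeEdge (leaf i) center (label i j)

  -- Journey t u w: journeys from u to w all of whose labels exceed t.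
  -- Labels are positive, so t = 0 imposes no restriction.
  data Journey (t : ℕ) : Vertex ℓ → Vertex ℓ → Set where
    []   : ∀ {u} → Journey t u u
    step : ∀ {u v w l} → TimeEdge u v l → t ℕ.< l → Journey l v w → Journey t u w

  visited : ∀ {t u w} → Journey t u w → List (Vertex ℓ)
  visited {u = u} []           = u ∷ []
  visited {u = u} (step _ _ J) = u ∷ visited J

  Explorable : Set
  Explorable = Σ (Journey 0 center center) λ J → ∀ v → v ∈ visited J

  private
    label≤α : ∀ i j → label i j ℕ.≤ α
    label≤α i j = toℕ<n (lookup (lookup G i) j)

    timeEdge≤α : ∀ {u v l} → TimeEdge u v l → l ℕ.≤ α
    timeEdge≤α (outward i j) = label≤α i j
    timeEdge≤α (inward  i j) = label≤α i j

    anyTimeEdge? : ∀ u {Q : Vertex ℓ → ℕ → Set} → (∀ v l → Dec (Q v l)) →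
                   Dec (∃[ v ] ∃[ l ] TimeEdge u v l × Q v l)
    anyTimeEdge? zero Q? with any? (λ i → any? (λ j → Q? (leaf i) (label i j)))
    ... | yes (i , j , q) = yes (_ , _ , outward i j , q)
    ... | no ¬q = no λ { (_ , _ , outward i j , q) → ¬q (i , j , q) }
    anyTimeEdge? (suc i) Q? with any? (λ j → Q? center (label i j))
    ... | yes (j , q) = yes (_ , _ , inward i j , q)
    ... | no ¬q = no λ { (_ , _ , inward i j , q) → ¬q (j , q) }

    module _ (w : Vertex ℓ) where

      JourneyWith : ℕ → Vertex ℓ → (List (Vertex ℓ) → Set) → Set
      JourneyWith t u P = Σ (Journey t u w) λ J → P (visited J)

      stay? : ∀ u {P : List (Vertex ℓ) → Set} → Decidable P →
              Dec (u ≡ w × P (u ∷ []))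
      stay? u P? with u ≟ w | P? (u ∷ [])
      ... | yes e | yes p = yes (e , p)
      ... | no ¬e | _     = no λ (e , _) → ¬e e
      ... | _     | no ¬p = no λ (_ , p) → ¬p p

      Next : ℕ → Vertex ℓ → (List (Vertex ℓ) → Set) → Vertex ℓ → ℕ → Set
      Next t u P v l = t ℕ.< l × JourneyWith l v (λ vs → P (u ∷ vs))

      -- Labels increase and are at most α, so a journey with labels
      -- exceeding t has at most α ∸ t ≤ d steps.
      anyJourney? : ∀ d t → α ℕ.≤ d ℕ.+ t → ∀ u {P : List (Vertex ℓ) → Set} →
                    Decidable P → Dec (JourneyWith t u P)

      next? : ∀ d t → α ℕ.≤ suc d ℕ.+ t → ∀ u {P : List (Vertex ℓ) → Set} →
              Decidable P → ∀ v l → Dec (Next t u P v l)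

      anyJourney? d t α≤d+t u P? with stay? u P?
      anyJourney? d t α≤d+t u P? | yes (refl , p) = yes ([] , p)
      anyJourney? zero t α≤t u P? | no ¬stay = no λ
        { ([] , p)           → ¬stay (refl , p)
        ; (step e t<l _ , _) → ℕ.<⇒≱ t<l (ℕ.≤-trans (timeEdge≤α e) α≤t) }
      anyJourney? (suc d) t α≤d+t u P? | no ¬stay
        with anyTimeEdge? u (next? d t α≤d+t u P?)
      ... | yes (_ , _ , e , t<l , J , p) = yes (step e t<l J , p)
      ... | no ¬next = no λ
        { ([] , p)           → ¬stay (refl , p)
        ; (step e t<l J , p) → ¬next (_ , _ , e , t<l , J , p) }

      next? d t α≤1+d+t u P? v l with t ℕ.<? l
      ... | no t≮l = no λ (t<l , _) → t≮l t<l
      ... | yes t<l with anyJourney? d l α≤d+l v (λ vs → P? (u ∷ vs))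
        where
        α≤d+l : α ℕ.≤ d ℕ.+ l
        α≤d+l = ℕ.≤-trans α≤1+d+t
          (subst (ℕ._≤ d ℕ.+ l) (ℕ.+-suc d t) (ℕ.+-monoʳ-≤ d t<l))
      ...   | yes J = yes (t<l , J)
      ...   | no ¬J = no λ (_ , J) → ¬J J

  explorable? : Dec Explorable
  explorable? = anyJourney? center α 0 (ℕ.m≤m+n α 0) center
    (λ vs → all? λ v → _∈?_ _≟_ v vs)

-- The probability that the uniform random temporal star on n ≥ 1 vertices
-- is explorable.  Independent uniform labels make all labellings of the
-- n - 1 edges equally likely.
ℙ-explorable : (n α k : ℕ) → ℚ
ℙ-explorable n α k = ℙ (labellings (pred n) α k) explorable?

{-# OPTIONS --safe #-}
module Submission where

-- Put b = ⌊α / 2n⌋ and cut the first 2nb labels into 2n blocks of length b.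
-- If every leaf i has a label in block 2i and one in block 2i + 1, the leaves
-- can be explored in order.  As b/α ≥ 1/(4n), an edge misses a given block with
-- probability at most (1 - 1/(4n))^k.  For t = ⌊log₂ n⌋ the dyadic bound
-- ln n ≥ t/2 gives k ≥ 3nt, and (1 - 1/(4n))^(3n) ≤ 32/65 < 1/2, so the union
-- bound over fewer than 2n ≤ 4·2^t blocks leaves a failure probability of at
-- most 4 (64/65)^t, which tends to 0.

open import Data.Fin as Fin using (Fin; zero; suc; toℕ; _↑ˡ_; _↑ʳ_)
open import Data.Fin.Properties using (all?; any?; toℕ-↑ˡ; toℕ-↑ʳ; toℕ<n)
open import Data.Integer as ℤ using (+_; +≤+; +<+)
import Data.Integer.Properties as ℤ
open import Data.List using (List; []; _∷_; map; _++_; length; filter; tabulate; allFin; cartesianProductWith)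
open import Data.List.Membership.Propositional using (_∈_)
open import Data.List.Properties using (length-map; length-++; filter-++; length-filter; length-tabulate)
open import Data.List.Relation.Binary.Sublist.Propositional using (⊆-refl)
open import Data.List.Relation.Binary.Sublist.Propositional.Properties using (filter⁺; length-mono-≤)
open import Data.List.Relation.Unary.Any using (here; there)
open import Data.Nat as ℕ using (ℕ; zero; suc; _+_; _*_; _∸_; _^_; _≤_; _<_; z≤n; s≤s; z<s; s<s; s≤s⁻¹; _≤?_; _<?_;
  NonZero; >-nonZero; ≢-nonZero⁻¹)
open import Data.Nat.DivMod using (m%n<n; m≡m%n+[m/n]*n; m/n≤m; m/n*n≤m; m≥n⇒m/n>0)
open import Data.Nat.Properties
open import Data.Nat.Tactic.RingSolver using (solve-∀)
open import Data.Product using (Σ; ∃-syntax; _×_; _,_; proj₁; proj₂)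
open import Data.Rational as ℚ using (0ℚ; 1ℚ; mkℚ; _/_; toℚᵘ)
import Data.Rational.Properties as ℚ
open import Data.Rational.Unnormalised as ℚᵘ using (mkℚᵘ)
import Data.Rational.Unnormalised.Properties as ℚᵘ
open import Data.Sum using (_⊎_; inj₁; inj₂)
open import Data.Vec using (Vec; []; _∷_; lookup)
open import Function using (_∘_; _⇔_; mk⇔; Equivalence)
open import Relation.Binary.PropositionalEquality
open import Relation.Nullary using (¬_; ¬?; yes; no; contradiction; _×-dec_)
open import Relation.Unary using (Decidable)
open import Defs

-- Journeys that visit the leaves in order

module _ {ℓ α k : ℕ} (G : Labelling ℓ α k) where

  -- The leaves are visited in the order of f.
  tour : ∀ {out back : Fin ℓ → Fin k} →
         (∀ i → label G i (out i) < label G i (back i)) →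
         (∀ {i j} → i Fin.< j → label G i (back i) < label G j (out j)) →
         ∀ m (f : Fin m → Fin ℓ) → (∀ {i j} → i Fin.< j → f i Fin.< f j) →
         ∀ t → (∀ i → t < label G (f i) (out (f i))) →
         Σ (Journey G t center center) λ J → ∀ i → leaf (f i) ∈ visited G J
  tour o<b b<o zero    f f-mono t t<out = [] , λ ()
  tour o<b b<o (suc m) f f-mono t t<out =
    -- The rest of the tour starts after the return from `f zero`, which `b<o` places before every
    -- later departure.
    let J , covers = tour o<b b<o m (f ∘ suc) (f-mono ∘ s<s) _ (λ i → b<o (f-mono z<s)) in
    step (outward (f zero) _) (t<out zero) (step (inward (f zero) _) (o<b (f zero)) J) ,
    λ { zero → there (here refl) ; (suc i) → there (there (covers i)) }

  start∈visited : ∀ {t u w} (J : Journey G t u w) → u ∈ visited G J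
  start∈visited []           = here refl
  start∈visited (step _ _ _) = here refl

  explorable : (out back : Fin ℓ → Fin k) →
               (∀ i → label G i (out i) < label G i (back i)) →
               (∀ {i j} → i Fin.< j → label G i (back i) < label G j (out j)) →
               Explorable G
  explorable out back o<b b<o =
    let J , covers = tour {out} {back} o<b b<o ℓ (λ i → i) (λ i<j → i<j) 0 (λ _ → z<s) in
    J , λ { zero → start∈visited J ; (suc i) → covers i }

-- Counting elements of lists

count : ∀ {A : Set} {P : A → Set} → Decidable P → List A → ℕ
count P? xs = length (filter P? xs)

count-mono : ∀ {A : Set} {P Q : A → Set} (P? : Decidable P) (Q? : Decidable Q) →
             (∀ x → P x → Q x) → ∀ xs → count P? xs ≤ count Q? xs
count-mono P? Q? P⊆Q xs = length-mono-≤ (filter⁺ P? Q? (λ { {x} refl → P⊆Q x }) (⊆-refl {x = xs}))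

count-∪ : ∀ {A : Set} {P Q R : A → Set} (P? : Decidable P) (Q? : Decidable Q) (R? : Decidable R) →
          (∀ x → P x → Q x ⊎ R x) → ∀ xs → count P? xs ≤ count Q? xs + count R? xs
count-∪ P? Q? R? P⊆Q∪R [] = z≤n
count-∪ P? Q? R? P⊆Q∪R (x ∷ xs) with P? x | Q? x | R? x | count-∪ P? Q? R? P⊆Q∪R xs
... | no _  | yes _ | yes _ | ih = m≤n⇒m≤1+n (≤-trans ih (+-monoʳ-≤ _ (n≤1+n _)))
... | no _  | yes _ | no _  | ih = m≤n⇒m≤1+n ih
... | no _  | no _  | yes _ | ih = ≤-trans ih (+-monoʳ-≤ _ (n≤1+n _))
... | no _  | no _  | no _  | ih = ih
... | yes _ | yes _ | yes _ | ih = s≤s (≤-trans ih (+-monoʳ-≤ _ (n≤1+n _)))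
... | yes _ | yes _ | no _  | ih = s≤s ih
... | yes _ | no _  | yes _ | ih = ≤-trans (s≤s ih) (≤-reflexive (sym (+-suc _ _)))
... | yes p | no ¬q | no ¬r | _  = contradiction (P⊆Q∪R x p) λ { (inj₁ q) → ¬q q ; (inj₂ r) → ¬r r }

module _ {A : Set} {P : A → Set} (P? : Decidable P) where

  count-++ : ∀ xs ys → count P? (xs ++ ys) ≡ count P? xs + count P? ys
  count-++ xs ys = trans (cong length (filter-++ P? xs ys)) (length-++ (filter P? xs))

  count-none : (∀ x → ¬ P x) → ∀ xs → count P? xs ≡ 0
  count-none ¬P [] = refl
  count-none ¬P (x ∷ xs) with P? x
  ... | yes p = contradiction p (¬P x)
  ... | no _  = count-none ¬P xs

  count-complement : ∀ xs → count P? xs + count (¬? ∘ P?) xs ≡ length xs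
  count-complement [] = refl
  count-complement (x ∷ xs) with P? x
  ... | yes p = cong suc (count-complement xs)
  ... | no ¬p = trans (+-suc _ _) (cong suc (count-complement xs))

  count-map : ∀ {B : Set} {Q : B → Set} (Q? : Decidable Q) (f : B → A) →
              (∀ y → P (f y) ⇔ Q y) → ∀ ys → count P? (map f ys) ≡ count Q? ys
  count-map Q? f P⇔Q [] = refl
  count-map Q? f P⇔Q (y ∷ ys) with P? (f y) | Q? y | count-map Q? f P⇔Q ys
  ... | yes p | yes q | ih = cong suc ih
  ... | yes p | no ¬q | ih = contradiction (Equivalence.to (P⇔Q y) p) ¬q
  ... | no ¬p | yes q | ih = contradiction (Equivalence.from (P⇔Q y) q) ¬p
  ... | no ¬p | no ¬q | ih = ih

  count-tabulate-suffix : ∀ s {m} (f : Fin (s + m) → A) →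
                          count P? (tabulate (f ∘ (s ↑ʳ_))) ≤ count P? (tabulate f)
  count-tabulate-suffix zero    f = ≤-refl
  count-tabulate-suffix (suc s) f with P? (f zero) | count-tabulate-suffix s (f ∘ suc)
  ... | yes _ | ih = m≤n⇒m≤1+n ih
  ... | no _  | ih = ih

  count-tabulate-prefix : ∀ b {r} (f : Fin (b + r) → A) → (∀ j → P (f (j ↑ˡ r))) →
                          b ≤ count P? (tabulate f)
  count-tabulate-prefix zero    f p = z≤n
  count-tabulate-prefix (suc b) f p with P? (f zero) | count-tabulate-prefix b (f ∘ suc) (p ∘ suc)
  ... | yes _ | ih = s≤s ih
  ... | no ¬p | ih = contradiction (p zero) ¬p

-- Product events on vectors

module _ {A : Set} where

  Everywhere : ∀ {m} → (Fin m → A → Set) → Vec A m → Set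
  Everywhere P v = ∀ i → P i (lookup v i)

  everywhere? : ∀ {m} {P : Fin m → A → Set} → (∀ i → Decidable (P i)) → Decidable (Everywhere P)
  everywhere? P? v = all? λ i → P? i (lookup v i)

  length-vectors : ∀ (xs : List A) m → length (vectors xs m) ≡ length xs ^ m
  length-vectors xs zero    = refl
  length-vectors xs (suc m) = go xs
    where
    go : ∀ ys → length (cartesianProductWith _∷_ ys (vectors xs m)) ≡ length ys * length xs ^ m
    go []       = refl
    go (y ∷ ys) = trans (length-++ (map (y ∷_) (vectors xs m)))
      (cong₂ _+_ (trans (length-map (y ∷_) (vectors xs m)) (length-vectors xs m)) (go ys))

  -- Independence of the coordinates in counting form: every admissible head combines with every
  -- admissible tail.
  count-vectors : ∀ {m} {P : Fin (suc m) → A → Set} (P? : ∀ i → Decidable (P i)) xs →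
                  count (everywhere? P?) (vectors xs (suc m)) ≡
                  count (P? zero) xs * count (everywhere? (P? ∘ suc)) (vectors xs m)
  count-vectors {m} {P} P? xs = go xs
    where
    vs = vectors xs m
    go : ∀ ys → count (everywhere? P?) (cartesianProductWith _∷_ ys vs) ≡
         count (P? zero) ys * count (everywhere? (P? ∘ suc)) vs
    go [] = refl
    go (y ∷ ys) with P? zero y | count-++ (everywhere? P?) (map (y ∷_) vs) (cartesianProductWith _∷_ ys vs)
    ... | yes p | eq = trans eq (cong₂ _+_
      (count-map (everywhere? P?) (everywhere? (P? ∘ suc)) (y ∷_)
        (λ v → mk⇔ (λ a i → a (suc i)) (λ { a zero → p ; a (suc i) → a i })) vs) (go ys))
    ... | no ¬p | eq = trans eq (cong₂ _+_
      (trans (count-map (everywhere? P?) (λ _ → no λ a → a) (y ∷_) (λ v → mk⇔ (λ a → ¬p (a zero)) (λ ())) vs)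
             (count-none (λ _ → no λ a → a) (λ _ a → a) vs)) (go ys))

  count-vectors-≤ : ∀ {m} {P : Fin m → A → Set} (P? : ∀ i → Decidable (P i)) xs {c} →
                    (∀ i → count (P? i) xs ≤ c) →
                    count (everywhere? P?) (vectors xs m) ≤ c ^ m
  count-vectors-≤ {zero}  P? xs h = length-filter (everywhere? P?) ([] ∷ [])
  count-vectors-≤ {suc m} P? xs h = ≤-trans (≤-reflexive (count-vectors P? xs))
    (*-mono-≤ (h zero) (count-vectors-≤ (P? ∘ suc) xs (h ∘ suc)))

  -- Bernoulli's inequality (1 - β/T)^m ≥ 1 - m β/T for a product of m
  -- unequal factors, multiplied by T^(m+1).
  count-vectors-≥ : ∀ {m} {P : Fin m → A → Set} (P? : ∀ i → Decidable (P i)) xs {β} →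
                    (∀ i → length xs ≤ count (P? i) xs + β) →
                    length xs * length xs ^ m ≤
                    length xs * count (everywhere? P?) (vectors xs m) + m * β * length xs ^ m
  count-vectors-≥ {zero} {P} P? xs h = ≤-trans (*-monoʳ-≤ (length xs) one) (m≤m+n _ _)
    where
    one : 1 ≤ count (everywhere? P?) ([] ∷ [])
    one with everywhere? P? []
    ... | yes _ = s≤s z≤n
    ... | no ¬p = contradiction (λ ()) ¬p
  count-vectors-≥ {suc m} P? xs {β} h = begin
    T * (T * T^m)                                     ≤⟨ *-monoʳ-≤ T (count-vectors-≥ (P? ∘ suc) xs (h ∘ suc)) ⟩
    T * (T * g + m * β * T^m)                         ≡⟨ regroup T g m β T^m ⟩
    T * (T * g) + m * β * (T * T^m)                   ≤⟨ +-monoˡ-≤ _ (*-monoʳ-≤ T (*-monoˡ-≤ g (h zero))) ⟩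
    T * ((c + β) * g) + m * β * (T * T^m)             ≡⟨ regroup′ T c β g (m * β * (T * T^m)) ⟩
    -- The bad heads, bounded by `β`, are charged against all tails, admissible or not; this adds
    -- one more `β` to the linear error term.
    T * (c * g) + (β * (T * g) + m * β * (T * T^m))   ≤⟨ +-monoʳ-≤ (T * (c * g)) (+-monoˡ-≤ _ (*-monoʳ-≤ β (*-monoʳ-≤ T g≤T^m))) ⟩
    T * (c * g) + (β * (T * T^m) + m * β * (T * T^m)) ≡⟨ cong₂ (λ u v → T * u + v) (sym (count-vectors P? xs)) (sym (*-distribʳ-+ (T * T^m) β (m * β))) ⟩
    T * count (everywhere? P?) (vectors xs (suc m)) + suc m * β * (T * T^m) ∎
    where
    open ≤-Reasoning
    T   = length xs
    T^m = length xs ^ m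
    c   = count (P? zero) xs
    g   = count (everywhere? (P? ∘ suc)) (vectors xs m)
    g≤T^m : g ≤ T^m
    g≤T^m = ≤-trans (length-filter (everywhere? (P? ∘ suc)) (vectors xs m)) (≤-reflexive (length-vectors xs m))
    regroup : ∀ T g m β S → T * (T * g + m * β * S) ≡ T * (T * g) + m * β * (T * S)
    regroup = solve-∀
    regroup′ : ∀ T c β g R → T * ((c + β) * g) + R ≡ T * (c * g) + (β * (T * g) + R)
    regroup′ = solve-∀

-- Blocks of labels and a criterion for explorability

-- The w-th block of b consecutive labels.  Leaf i is reached by a label in
-- block 2i and left by a label in block 2i + 1.
Block : (b w : ℕ) → ∀ {α} → Fin α → Set
Block b w x = w * b ≤ toℕ x × toℕ x < suc w * b

block? : ∀ b w {α} → Decidable (Block b w {α})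
block? b w x = (w * b ≤? toℕ x) ×-dec (toℕ x <? suc w * b)

block-< : ∀ {b w w′ α} {x y : Fin α} → w < w′ → Block b w x → Block b w′ y → toℕ x < toℕ y
block-< {b} w<w′ (_ , x<) (≤y , _) = <-≤-trans x< (≤-trans (*-monoˡ-≤ b w<w′) ≤y)

-- The labels split into `w * b` before the block, `b` inside it and `r` after it. Once the first
-- piece is dropped, the block is a prefix.
count-block : ∀ b w {α} → suc w * b ≤ α → b ≤ count (block? b w) (allFin α)
count-block b w {α} end≤α with m≤n⇒∃[o]m+o≡n end≤α
... | r , refl = subst (λ a → b ≤ count (block? b w) (allFin a)) (reorder b (w * b) r)
    (≤-trans (count-tabulate-prefix (block? b w) b (w * b ↑ʳ_) inBlock)
      (count-tabulate-suffix (block? b w) (w * b) {b + r} (λ i → i)))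
  where
  reorder : ∀ b s r → s + (b + r) ≡ b + s + r
  reorder = solve-∀
  inBlock : ∀ j → Block b w (w * b ↑ʳ (j ↑ˡ r))
  inBlock j rewrite toℕ-↑ʳ (w * b) (j ↑ˡ r) | toℕ-↑ˡ j r =
    m≤m+n (w * b) (toℕ j) , ≤-trans (+-monoʳ-< (w * b) (toℕ<n j)) (≤-reflexive (+-comm (w * b) b))

Hits : (b w : ℕ) → ∀ {α k} → Vec (Fin α) k → Set
Hits b w row = ∃[ j ] Block b w (lookup row j)

hits? : ∀ b w {α k} → Decidable (Hits b w {α} {k})
hits? b w row = any? λ j → block? b w (lookup row j)

HitsBoth : (b i : ℕ) → ∀ {α k} → Vec (Fin α) k → Set
HitsBoth b i row = Hits b (2 * i) row × Hits b (suc (2 * i)) row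

hitsBoth? : ∀ b i {α k} → Decidable (HitsBoth b i {α} {k})
hitsBoth? b i row = hits? b (2 * i) row ×-dec hits? b (suc (2 * i)) row

-- The two hits of a leaf supply its `out` and `back` labels. Block `2i` precedes block `2i + 1`,
-- and `i < j` gives `2i + 2 ≤ 2j`, so the return from `i` precedes the departure to `j`.
hits⇒explorable : ∀ {b ℓ α k} (G : Labelling ℓ α k) →
                  Everywhere (λ i → HitsBoth b (toℕ i)) G → Explorable G
hits⇒explorable {b} G hits = explorable G (proj₁ ∘ proj₁ ∘ hits) (proj₁ ∘ proj₂ ∘ hits)
  (λ i → s<s (block-< {b} {2 * toℕ i} (n<1+n _) (proj₂ (proj₁ (hits i))) (proj₂ (proj₂ (hits i)))))
  (λ {i} {j} i<j → s<s (block-< {b} {suc (2 * toℕ i)} {2 * toℕ j} (≤-trans (≤-reflexive (sym (*-suc 2 (toℕ i)))) (*-monoʳ-≤ 2 i<j))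
    (proj₂ (proj₂ (hits i))) (proj₂ (proj₁ (hits j)))))

-- Union bound over the missed blocks

module _ {b c α : ℕ} (b+c≡α : b + c ≡ α) where

  -- Missing the block is a product event: each of the `k` labels avoids it, with at most
  -- `c = α - b` choices.
  count-misses : ∀ k w → suc w * b ≤ α →
                 count (¬? ∘ hits? b w) (vectors (allFin α) k) ≤ c ^ k
  count-misses k w end≤α = ≤-trans
    (count-mono (¬? ∘ hits? b w) (everywhere? (λ _ → ¬? ∘ block? b w)) (λ _ ¬h j x → ¬h (j , x)) (vectors (allFin α) k))
    (count-vectors-≤ {m = k} (λ _ → ¬? ∘ block? b w) (allFin α) λ _ → outside)
    where
    outside : count (¬? ∘ block? b w) (allFin α) ≤ c
    outside = +-cancelˡ-≤ b _ _ (begin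
      b + count (¬? ∘ block? b w) (allFin α)
        ≤⟨ +-monoˡ-≤ _ (count-block b w end≤α) ⟩
      count (block? b w) (allFin α) + count (¬? ∘ block? b w) (allFin α)
        ≡⟨ trans (count-complement (block? b w) (allFin α)) (trans (length-tabulate {n = α} (λ i → i)) (sym b+c≡α)) ⟩
      b + c ∎)
      where open ≤-Reasoning

  count-hitsBoth : ∀ k i → 2 * suc i * b ≤ α →
                   length (vectors (allFin α) k) ≤
                   count (hitsBoth? b i) (vectors (allFin α) k) + 2 * c ^ k
  count-hitsBoth k i end≤α = begin
    length rows
      ≡⟨ sym (count-complement (hitsBoth? b i) rows) ⟩
    count (hitsBoth? b i) rows + count (¬? ∘ hitsBoth? b i) rows
      ≤⟨ +-monoʳ-≤ (count (hitsBoth? b i) rows) misses ⟩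
    count (hitsBoth? b i) rows + 2 * c ^ k ∎
    where
    open ≤-Reasoning
    rows = vectors (allFin α) k
    misses : count (¬? ∘ hitsBoth? b i) rows ≤ 2 * c ^ k
    misses = begin
      count (¬? ∘ hitsBoth? b i) rows
        ≤⟨ count-∪ (¬? ∘ hitsBoth? b i) (¬? ∘ hits? b (2 * i)) (¬? ∘ hits? b (suc (2 * i))) one-misses rows ⟩
      count (¬? ∘ hits? b (2 * i)) rows + count (¬? ∘ hits? b (suc (2 * i))) rows
        ≤⟨ +-mono-≤ (count-misses k (2 * i) (≤-trans (m≤n+m _ b) end≤α′)) (count-misses k (suc (2 * i)) end≤α′) ⟩
      c ^ k + c ^ k
        ≡⟨ cong (λ x → c ^ k + x) (sym (+-identityʳ (c ^ k))) ⟩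
      2 * c ^ k ∎
      where
      end≤α′ : suc (suc (2 * i)) * b ≤ α
      end≤α′ = subst (λ w → w * b ≤ α) (*-suc 2 i) end≤α
      -- This De Morgan law is constructive because the first hit is decidable.
      one-misses : ∀ row → ¬ HitsBoth b i row → ¬ Hits b (2 * i) row ⊎ ¬ Hits b (suc (2 * i)) row
      one-misses row ¬both with hits? b (2 * i) row
      ... | yes out = inj₂ λ back → ¬both (out , back)
      ... | no ¬out = inj₁ ¬out

length-rows : ∀ α k → length (vectors (allFin α) k) ≡ α ^ k
length-rows α k = trans (length-vectors (allFin α) k) (cong (_^ k) (length-tabulate {n = α} (λ i → i)))

-- The expected number of missed blocks bounds the probability of failure.
failure-bound : ∀ {b c ℓ α} k → b + c ≡ α → 2 * ℓ * b ≤ α →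
                let Ω = labellings ℓ α k in
                α ^ k * length Ω ≤ α ^ k * count explorable? Ω + ℓ * (2 * c ^ k) * length Ω
failure-bound {b} {c} {ℓ} {α} k b+c≡α blocks≤α
  -- With `α ^ k` and `length Ω` expressed through the number `T` of rows, this is `count-vectors-≥`
  -- with `β = 2 * c ^ k`.
  rewrite length-vectors (vectors (allFin α) k) ℓ | sym (length-rows α k) = begin
    T * T ^ ℓ
      ≤⟨ count-vectors-≥ {m = ℓ} (λ i → hitsBoth? b (toℕ i)) rows
           (λ i → count-hitsBoth b+c≡α k (toℕ i)
             (≤-trans (*-monoˡ-≤ b (*-monoʳ-≤ 2 (toℕ<n i))) blocks≤α)) ⟩
    T * count (everywhere? (λ i → hitsBoth? b (toℕ i))) (labellings ℓ α k) + ℓ * (2 * c ^ k) * T ^ ℓ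
      ≤⟨ +-monoˡ-≤ _ (*-monoʳ-≤ T (count-mono (everywhere? (λ i → hitsBoth? b (toℕ i))) explorable?
           (hits⇒explorable {b}) (labellings ℓ α k))) ⟩
    T * count explorable? (labellings ℓ α k) + ℓ * (2 * c ^ k) * T ^ ℓ ∎
  where
  open ≤-Reasoning
  rows = vectors (allFin α) k
  T    = length rows

-- Estimates for powers

^-distribʳ-* : ∀ m n o → (m * n) ^ o ≡ m ^ o * n ^ o
^-distribʳ-* m n zero    = refl
^-distribʳ-* m n (suc o) = trans (cong (m * n *_) (^-distribʳ-* m n o)) ([m*n]*[o*p]≡[m*o]*[n*p] m n (m ^ o) (n ^ o))

-- (1 + 1/M)^j ≥ 1 + j/M + j(j - 1)/(2M²) for j = i + 1.
binomial₂ : ∀ M i → M ^ suc i * (2 * M * M + 2 * suc i * M + suc i * i) ≤ 2 * M * M * suc M ^ suc i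
binomial₂ M zero = ≤-reflexive (base M)
  where
  base : ∀ M → M * 1 * (2 * M * M + 2 * 1 * M + 1 * 0) ≡ 2 * M * M * ((1 + M) * 1)
  base = solve-∀
binomial₂ M (suc i) = begin
  -- Multiplying the quadratic truncation by `1 + 1/M` produces one term of third order,
  -- `M^j * (suc i * i)` in this scaling, which is dropped.
  M * M^j * B (suc i)         ≤⟨ ≤-trans (m≤m+n _ (M^j * (suc i * i))) (≤-reflexive (expand M M^j i)) ⟩
  M^j * B i * suc M           ≤⟨ *-monoˡ-≤ (suc M) (binomial₂ M i) ⟩
  2 * M * M * suc M ^ suc i * suc M ≡⟨ trans (*-assoc (2 * M * M) _ _) (cong (2 * M * M *_) (*-comm _ (suc M))) ⟩
  2 * M * M * suc M ^ suc (suc i) ∎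
  where
  open ≤-Reasoning
  M^j = M ^ suc i
  B : ℕ → ℕ
  B i = 2 * M * M + 2 * suc i * M + suc i * i
  expand : ∀ M P i → M * P * (2 * M * M + 2 * (2 + i) * M + (2 + i) * (1 + i)) + P * ((1 + i) * i) ≡
           P * (2 * M * M + 2 * (1 + i) * M + (1 + i) * i) * (1 + M)
  expand = solve-∀

module _ {b c α p : ℕ} (b+c≡α : b + c ≡ α) (α≤4nb : α ≤ 4 * suc p * b) where

  -- (1 + 1/M)^j ≥ 65/32 for j = 3n and M = 4n - 1, where n = p + 1.
  decay₁ : 65 * c ^ (3 * suc p) ≤ 32 * α ^ (3 * suc p)
  decay₁ = subst (λ j → 65 * c ^ j ≤ 32 * α ^ j) (sym (index p))
    (*-cancelˡ-≤ (2 * M * M) (*-cancelˡ-≤ M^j {{m^n≢0 M (suc i)}} (begin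
      M^j * (2 * M * M * (65 * c ^ suc i))
        ≡⟨ swap₁ M^j (2 * M * M) (c ^ suc i) ⟩
      M^j * (65 * (2 * M * M)) * c ^ suc i
        ≤⟨ *-monoˡ-≤ (c ^ suc i) (*-monoʳ-≤ M^j (≤-trans (m≤m+n _ (240 * p + 174)) (≤-reflexive (quadratic p)))) ⟩
      M^j * (32 * B) * c ^ suc i
        ≡⟨ swap₂ M^j B (c ^ suc i) ⟩
      32 * (M^j * B * c ^ suc i)
        ≤⟨ *-monoʳ-≤ 32 (*-monoˡ-≤ (c ^ suc i) (binomial₂ M i)) ⟩
      32 * (2 * M * M * suc M ^ suc i * c ^ suc i)
        ≡⟨ cong (32 *_) (trans (*-assoc (2 * M * M) (suc M ^ suc i) (c ^ suc i)) (cong (2 * M * M *_) (sym (^-distribʳ-* (suc M) c (suc i))))) ⟩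
      32 * (2 * M * M * (suc M * c) ^ suc i)
        ≤⟨ *-monoʳ-≤ 32 (*-monoʳ-≤ (2 * M * M) (^-monoˡ-≤ (suc i) 1+M*c≤M*α)) ⟩
      32 * (2 * M * M * (M * α) ^ suc i)
        ≡⟨ cong (λ x → 32 * (2 * M * M * x)) (^-distribʳ-* M α (suc i)) ⟩
      32 * (2 * M * M * (M^j * α ^ suc i))
        ≡⟨ swap₃ M^j (2 * M * M) (α ^ suc i) ⟩
      M^j * (2 * M * M * (32 * α ^ suc i)) ∎)))
      where
      open ≤-Reasoning
      i = 3 * p + 2
      -- `4n - 1`, written as a successor so that cancelling its powers finds it nonzero.
      M = suc (4 * p + 2)
      M^j = M ^ suc i
      B = 2 * M * M + 2 * suc i * M + suc i * i
      index : ∀ p → 3 * suc p ≡ suc (3 * p + 2)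
      index = solve-∀
      -- As `p` grows, `j/M` tends to 3/4 and the quadratic truncation to 1 + 3/4 + 9/32 = 65/32.
      -- The surplus `240 * p + 174` shows that it stays above this limit.
      quadratic : ∀ p → 65 * (2 * (1 + (4 * p + 2)) * (1 + (4 * p + 2))) + (240 * p + 174) ≡
                  32 * (2 * (1 + (4 * p + 2)) * (1 + (4 * p + 2)) + 2 * (1 + (3 * p + 2)) * (1 + (4 * p + 2))
                        + (1 + (3 * p + 2)) * (3 * p + 2))
      quadratic = solve-∀
      swap₁ : ∀ P m C → P * (m * (65 * C)) ≡ P * (65 * m) * C
      swap₁ = solve-∀
      swap₂ : ∀ P B C → P * (32 * B) * C ≡ 32 * (P * B * C)
      swap₂ = solve-∀
      swap₃ : ∀ P m A → 32 * (m * (P * A)) ≡ P * (m * (32 * A))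
      swap₃ = solve-∀
      4n : ∀ p b → 4 * suc p * b ≡ b + suc (4 * p + 2) * b
      4n = solve-∀
      c≤M*b : c ≤ M * b
      c≤M*b = +-cancelˡ-≤ b c (M * b) (subst₂ _≤_ (sym b+c≡α) (4n p b) α≤4nb)
      -- That is, `c/α ≤ M/(M + 1) = 1 - 1/(4n)`.
      1+M*c≤M*α : suc M * c ≤ M * α
      1+M*c≤M*α = begin
        c + M * c     ≤⟨ +-monoˡ-≤ (M * c) c≤M*b ⟩
        M * b + M * c ≡⟨ sym (*-distribˡ-+ M b c) ⟩
        M * (b + c)   ≡⟨ cong (M *_) b+c≡α ⟩
        M * α         ∎

  -- The `t`-th power of `decay₁` uses `3nt` of the `k` factors; the others are bounded by `c ≤ α`.
  decay : ∀ {t k} → 3 * suc p * t ≤ k → 65 ^ t * c ^ k ≤ 32 ^ t * α ^ k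
  decay {t} {k} 3nt≤k with m≤n⇒∃[o]m+o≡n 3nt≤k
  ... | r , refl = begin
    65 ^ t * c ^ (j * t + r)         ≡⟨ split 65 c ⟩
    (65 * c ^ j) ^ t * c ^ r         ≤⟨ *-mono-≤ (^-monoˡ-≤ t decay₁) (^-monoˡ-≤ r c≤α) ⟩
    (32 * α ^ j) ^ t * α ^ r         ≡⟨ sym (split 32 α) ⟩
    32 ^ t * α ^ (j * t + r)         ∎
    where
    open ≤-Reasoning
    j = 3 * suc p
    c≤α : c ≤ α
    c≤α = ≤-trans (m≤n+m c b) (≤-reflexive b+c≡α)
    split : ∀ m x → m ^ t * x ^ (j * t + r) ≡ (m * x ^ j) ^ t * x ^ r
    split m x = begin-equality
      m ^ t * x ^ (j * t + r)       ≡⟨ cong (m ^ t *_) (^-distribˡ-+-* x (j * t) r) ⟩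
      m ^ t * (x ^ (j * t) * x ^ r) ≡⟨ sym (*-assoc (m ^ t) _ _) ⟩
      m ^ t * x ^ (j * t) * x ^ r   ≡⟨ cong (λ y → m ^ t * y * x ^ r) (sym (^-*-assoc x j t)) ⟩
      m ^ t * (x ^ j) ^ t * x ^ r   ≡⟨ cong (_* x ^ r) (sym (^-distribʳ-* m (x ^ j) t)) ⟩
      (m * x ^ j) ^ t * x ^ r       ∎

-- Bernoulli's inequality for `(1 + 1/64)^t`. It makes the decay of `(64/65)^t` explicit, as at most
-- `64/(64 + t)`.
bernoulli : ∀ t → (64 + t) * 64 ^ t ≤ 64 * 65 ^ t
bernoulli zero    = ≤-refl
bernoulli (suc t) = begin
  (64 + suc t) * (64 * 64 ^ t)   ≤⟨ ≤-trans (m≤m+n _ (t * 64 ^ t)) (≤-reflexive (expand t (64 ^ t))) ⟩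
  65 * ((64 + t) * 64 ^ t)       ≤⟨ *-monoʳ-≤ 65 (bernoulli t) ⟩
  65 * (64 * 65 ^ t)             ≡⟨ swap (65 ^ t) ⟩
  64 * (65 * 65 ^ t)             ∎
  where
  open ≤-Reasoning
  expand : ∀ t x → (64 + (1 + t)) * (64 * x) + t * x ≡ 65 * ((64 + t) * x)
  expand = solve-∀
  swap : ∀ x → 65 * (64 * x) ≡ 64 * (65 * x)
  swap = solve-∀

binary-log : ∀ n → ∃[ t ] 2 ^ t ≤ suc n × suc n < 2 ^ suc t
binary-log zero = 0 , ≤-refl , ≤-refl
binary-log (suc n) with binary-log n
... | t , lo , hi with suc (suc n) <? 2 ^ suc t
...   | yes hi′ = t , m≤n⇒m≤1+n lo , hi′
...   | no ¬hi′ = suc t , ≮⇒≥ ¬hi′ , ≤-<-trans hi (^-monoʳ-< 2 ≤-refl (n<1+n (suc t)))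

-- Fractions of natural numbers

-- `_/_` reduces to lowest terms. Passing to unnormalised fractions turns comparison and arithmetic
-- into cross multiplication.
toℚᵘ-/ : ∀ a b → toℚᵘ (+ a / suc b) ℚᵘ.≃ mkℚᵘ (+ a) b
toℚᵘ-/ a b = ℚ.toℚᵘ-fromℚᵘ (mkℚᵘ (+ a) b)

module _ (a b c d : ℕ) where

  /-mono-≤ : a * suc d ≤ c * suc b → + a / suc b ℚ.≤ + c / suc d
  /-mono-≤ le = ℚ.toℚᵘ-cancel-≤ (ℚᵘ.≤-respˡ-≃ (ℚᵘ.≃-sym (toℚᵘ-/ a b)) (ℚᵘ.≤-respʳ-≃ (ℚᵘ.≃-sym (toℚᵘ-/ c d))
    (ℚᵘ.*≤* (subst₂ ℤ._≤_ (ℤ.pos-* a (suc d)) (ℤ.pos-* c (suc b)) (+≤+ le)))))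

  /-mono-< : a * suc d < c * suc b → + a / suc b ℚ.< + c / suc d
  /-mono-< lt = ℚ.toℚᵘ-cancel-< (ℚᵘ.<-respˡ-≃ (ℚᵘ.≃-sym (toℚᵘ-/ a b)) (ℚᵘ.<-respʳ-≃ (ℚᵘ.≃-sym (toℚᵘ-/ c d))
    (ℚᵘ.*<* (subst₂ ℤ._<_ (ℤ.pos-* a (suc d)) (ℤ.pos-* c (suc b)) (+<+ lt)))))

  /-cancel-≤ : + a / suc b ℚ.≤ + c / suc d → a * suc d ≤ c * suc b
  /-cancel-≤ le with ℚᵘ.≤-respˡ-≃ (toℚᵘ-/ a b) (ℚᵘ.≤-respʳ-≃ (toℚᵘ-/ c d) (ℚ.toℚᵘ-mono-≤ le))
  ... | ℚᵘ.*≤* le′ = ℤ.drop‿+≤+ (subst₂ ℤ._≤_ (sym (ℤ.pos-* a (suc d))) (sym (ℤ.pos-* c (suc b))) le′)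

  /-+ : + a / suc b ℚ.+ + c / suc d ≡ + (a * suc d + c * suc b) / (suc b * suc d)
  /-+ = ℚ.toℚᵘ-injective (ℚᵘ.≃-trans (ℚ.toℚᵘ-homo-+ (+ a / suc b) (+ c / suc d))
    (ℚᵘ.≃-trans (ℚᵘ.+-cong (toℚᵘ-/ a b) (toℚᵘ-/ c d))
    (ℚᵘ.≃-trans (ℚᵘ.≃-reflexive (cong (λ i → mkℚᵘ i _) (sym numerator))) (ℚᵘ.≃-sym (toℚᵘ-/ _ _)))))
    where
    numerator : + (a * suc d + c * suc b) ≡ + a ℤ.* + suc d ℤ.+ + c ℤ.* + suc b
    numerator = trans (ℤ.pos-+ (a * suc d) (c * suc b)) (cong₂ ℤ._+_ (ℤ.pos-* a (suc d)) (ℤ.pos-* c (suc b)))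

  /-* : + a / suc b ℚ.* (+ c / suc d) ≡ + (a * c) / (suc b * suc d)
  /-* = ℚ.toℚᵘ-injective (ℚᵘ.≃-trans (ℚ.toℚᵘ-homo-* (+ a / suc b) (+ c / suc d))
    (ℚᵘ.≃-trans (ℚᵘ.*-cong (toℚᵘ-/ a b) (toℚᵘ-/ c d))
    (ℚᵘ.≃-trans (ℚᵘ.≃-reflexive (cong (λ i → mkℚᵘ i _) (sym (ℤ.pos-* a c)))) (ℚᵘ.≃-sym (toℚᵘ-/ _ _)))))

-- Harmonic sums and the logarithm

-- The `s` terms after the first `r` have denominators at most `a + r + s`, so each is at least
-- `1 / suc d`.
harmonic-block : ∀ a r s d → a + r + s ≤ suc d →
                 harmonic a r ℚ.+ + s / suc d ℚ.≤ harmonic a (r + s)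
harmonic-block a r zero d end≤ = ℚ.≤-reflexive (trans (cong (harmonic a r ℚ.+_) (ℚ.0/n≡0 (suc d)))
  (trans (ℚ.+-identityʳ (harmonic a r)) (cong (harmonic a) (sym (+-identityʳ r)))))
harmonic-block a r (suc s) d end≤ rewrite +-suc r s = begin
  harmonic a r ℚ.+ + suc s / suc d                     ≤⟨ ℚ.+-monoʳ-≤ (harmonic a r) split ⟩
  harmonic a r ℚ.+ (+ s / suc d ℚ.+ + 1 / suc d)       ≡⟨ sym (ℚ.+-assoc (harmonic a r) (+ s / suc d) (+ 1 / suc d)) ⟩
  harmonic a r ℚ.+ + s / suc d ℚ.+ + 1 / suc d         ≤⟨ ℚ.+-mono-≤ (harmonic-block a r s d (≤-trans (n≤1+n _) end≤′)) last ⟩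
  harmonic a (r + s) ℚ.+ + 1 / suc (a + (r + s))       ∎
  where
  open ℚ.≤-Reasoning
  end≤′ : suc (a + r + s) ≤ suc d
  end≤′ = subst (_≤ suc d) (+-suc (a + r) s) end≤
  last : + 1 / suc d ℚ.≤ + 1 / suc (a + (r + s))
  last = /-mono-≤ 1 d 1 (a + (r + s)) (*-monoʳ-≤ 1 (subst (λ x → suc x ≤ suc d) (+-assoc a r s) end≤′))
  split : + suc s / suc d ℚ.≤ + s / suc d ℚ.+ + 1 / suc d
  split = ℚ.≤-trans (/-mono-≤ (suc s) d (s * suc d + 1 * suc d) _ (≤-reflexive (eq s (suc d))))
                    (ℚ.≤-reflexive (sym (/-+ s d 1 d)))
    where
    eq : ∀ s d → (1 + s) * (d * d) ≡ (s * d + 1 * d) * d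
    eq = solve-∀

-- Each dyadic block 2^t < i ≤ 2^(t+1) contributes at least 1/2; the first two
-- blocks 1/2 + 1/3 + 1/4 > 1 make the bound strict.
harmonic-dyadic : ∀ t r → 2 ^ (2 + t) ≤ suc r → + (2 + t) / 2 ℚ.< harmonic 1 r
harmonic-dyadic zero r 4≤1+r with m≤n⇒∃[o]m+o≡n (s≤s⁻¹ 4≤1+r)
... | s , refl = begin-strict
  + 2 / 2                              <⟨ ℚ.*<* (+<+ ≤-refl) ⟩
  harmonic 1 3                         ≡⟨ sym (ℚ.+-identityʳ (harmonic 1 3)) ⟩
  harmonic 1 3 ℚ.+ 0ℚ                  ≤⟨ ℚ.+-monoʳ-≤ (harmonic 1 3) (/-mono-≤ 0 0 s (3 + s) z≤n) ⟩
  harmonic 1 3 ℚ.+ + s / suc (3 + s)   ≤⟨ harmonic-block 1 3 s (3 + s) ≤-refl ⟩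
  harmonic 1 (3 + s)                   ∎
  where open ℚ.≤-Reasoning
harmonic-dyadic (suc t) r le = go (2 ^ (2 + t)) refl le
  where
  open ℚ.≤-Reasoning
  -- The power is generalised to `m` so that it can be matched as `suc r′`; then `harmonic 1 r′`
  -- ends at the denominator `2 ^ (2 + t)`.
  go : ∀ m → m ≡ 2 ^ (2 + t) → 2 * m ≤ suc r → + (3 + t) / 2 ℚ.< harmonic 1 r
  go zero eq _ = contradiction (sym eq) (≢-nonZero⁻¹ _ {{m^n≢0 2 (2 + t)}})
  go (suc r′) eq 2m≤1+r with m≤n⇒∃[o]m+o≡n (s≤s⁻¹ 2m≤1+r)
  ... | o , refl = begin-strict
    + (3 + t) / 2                                  ≤⟨ /-mono-≤ (3 + t) 1 ((2 + t) * 2 + 1 * 2) 3 (≤-reflexive (half t)) ⟩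
    + ((2 + t) * 2 + 1 * 2) / 4                    ≡⟨ sym (/-+ (2 + t) 1 1 1) ⟩
    + (2 + t) / 2 ℚ.+ + 1 / 2                      <⟨ ℚ.+-monoˡ-< (+ 1 / 2) (harmonic-dyadic t r′ (≤-reflexive (sym eq))) ⟩
    harmonic 1 r′ ℚ.+ + 1 / 2                      ≤⟨ ℚ.+-monoʳ-≤ (harmonic 1 r′) (/-mono-≤ 1 1 s d
                                                        (≤-trans (m≤m+n _ o) (≤-reflexive (double r′ o)))) ⟩
    harmonic 1 r′ ℚ.+ + s / suc d                  ≤⟨ harmonic-block 1 r′ s d (s≤s (≤-reflexive (total r′ o))) ⟩
    harmonic 1 (r′ + s)                            ≡⟨ cong (harmonic 1) (total r′ o) ⟩
    harmonic 1 d                                   ∎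
    where
    -- `s` terms remain, up to the denominator `suc d`, and `2 * s ≥ suc d`, so they add at least
    -- 1/2.
    s = suc r′ + o
    d = r′ + 1 * suc r′ + o
    half : ∀ t → (3 + t) * 4 ≡ ((2 + t) * 2 + 1 * 2) * 2
    half = solve-∀
    double : ∀ r o → 1 * (1 + (r + 1 * (1 + r) + o)) + o ≡ (1 + r + o) * 2
    double = solve-∀
    total : ∀ r o → r + (1 + r + o) ≡ r + 1 * (1 + r) + o
    total = solve-∀

-- For `t ≥ 2` the number `t/2` lies in the lower cut of `ln n`, where `n = suc ℓ`. The hypothesis
-- on `k` then gives `k ≥ 6n · t/2`.
log-bound : ∀ {t k ℓ} → 2 ≤ t → 2 ^ t ≤ suc ℓ → fromℕ k ≥ fromℕ (6 * suc ℓ) ·ln suc ℓ → 3 * suc ℓ * t ≤ k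
log-bound {suc zero} (s≤s ())
log-bound {suc (suc t)} {k} {ℓ} _ 2^t≤n k≥ = *-cancelʳ-≤ _ k 2 (begin
  3 * suc ℓ * (2 + t) * 2   ≡⟨ regroup ℓ t ⟩
  6 * suc ℓ * (2 + t) * 1   ≤⟨ /-cancel-≤ (6 * suc ℓ * (2 + t)) 1 k 0
                                 (subst (ℚ._≤ fromℕ k) (/-* (6 * suc ℓ) 0 (2 + t) 1) (k≥ (+ (2 + t) / 2) below)) ⟩
  k * 2                     ∎)
  where
  open ≤-Reasoning
  regroup : ∀ ℓ t → 3 * (1 + ℓ) * (2 + t) * 2 ≡ 6 * (1 + ℓ) * (2 + t) * 1
  regroup = solve-∀
  below : (+ (2 + t) / 2) <ln suc ℓ
  -- Mesh 1 suffices: the lower sum is `1/2 + ... + 1/n`, with length `ℓ * 1` after reduction.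
  below = 1 , subst (λ r → + (2 + t) / 2 ℚ.< harmonic 1 r) (sym (*-identityʳ ℓ)) (harmonic-dyadic t ℓ 2^t≤n)

-- Convergence of the probability

-- The last hypothesis says `1 - E/Ω < 1/q` for the denominator `q` of `ε`, and `1/q ≤ ε` because a
-- positive `ε` has numerator at least 1.
ratio-near-1 : ∀ {E Ω} ε → 0ℚ ℚ.< ε → E ≤ Ω → ℚ.↧ₙ ε * Ω < ℚ.↧ₙ ε * E + Ω →
               ℚ.∣ ratio E Ω ℚ.- 1ℚ ∣ ℚ.< ε
ratio-near-1 (mkℚ (+ zero) _ _) (ℚ.*<* (+<+ ())) _ _
ratio-near-1 (mkℚ ℤ.-[1+ _ ] _ _) (ℚ.*<* ()) _ _
-- For `Ω = 0`, where `ratio` is 0 by convention, the strict hypothesis is false.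
ratio-near-1 {zero} {zero} (mkℚ _ _ _) _ _ lt = contradiction lt (<⇒≱ (s≤s (≤-reflexive (+-identityʳ _))))
ratio-near-1 {E} {suc ω} ε@(mkℚ (+ suc p) q c) _ E≤Ω lt = begin-strict
  ℚ.∣ r ℚ.- 1ℚ ∣          ≡⟨ sym (ℚ.∣-p∣≡∣p∣ (r ℚ.- 1ℚ)) ⟩
  ℚ.∣ ℚ.- (r ℚ.- 1ℚ) ∣    ≡⟨ cong ℚ.∣_∣ neg-sub ⟩
  ℚ.∣ 1ℚ ℚ.- r ∣          ≡⟨ ℚ.0≤p⇒∣p∣≡p (subst (ℚ._≤ 1ℚ ℚ.- r) (ℚ.+-inverseʳ r) (ℚ.+-monoˡ-≤ (ℚ.- r) r≤1)) ⟩
  1ℚ ℚ.- r                <⟨ ℚ.+-monoˡ-< (ℚ.- r) 1<ε+r ⟩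
  ε ℚ.+ r ℚ.- r           ≡⟨ trans (ℚ.+-assoc ε r (ℚ.- r)) (trans (cong (ε ℚ.+_) (ℚ.+-inverseʳ r)) (ℚ.+-identityʳ ε)) ⟩
  ε                       ∎
  where
  open ℚ.≤-Reasoning
  r = ratio E (suc ω)
  neg-sub : ℚ.- (r ℚ.- 1ℚ) ≡ 1ℚ ℚ.- r
  neg-sub = trans (ℚ.neg-distrib-+ r (ℚ.- 1ℚ)) (ℚ.+-comm (ℚ.- r) 1ℚ)
  r≤1 : r ℚ.≤ 1ℚ
  r≤1 = /-mono-≤ E ω 1 0 (subst₂ _≤_ (sym (*-identityʳ E)) (sym (*-identityˡ (suc ω))) E≤Ω)
  1<ε+r : 1ℚ ℚ.< ε ℚ.+ r
  1<ε+r = subst (1ℚ ℚ.<_) (trans (sym (/-+ (suc p) q E ω)) (cong (ℚ._+ r) (ℚ.↥p/↧p≡p ε)))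
    (/-mono-< 1 0 (suc p * suc ω + E * suc q) _
      (≤-trans (subst₂ _<_ (sym (*-identityˡ _)) (+-comm (suc q * E) (suc ω)) lt)
        (≤-trans (+-mono-≤ (m≤m+n (suc ω) (p * suc ω)) (≤-reflexive (*-comm (suc q) E)))
          (≤-reflexive (sym (*-identityʳ _))))))

-- The failure probability is at most `2ℓ (c/α)^k ≤ 4 · 2^t (32/65)^t = 4 (64/65)^t ≤ 256/(64 +
-- t)`. The factors `α ^ k` and `65 ^ t` clear the denominators and are cancelled.
explorable-count : ∀ ℓ α k t → 2 * suc ℓ ≤ α → 3 * suc ℓ * t ≤ k → suc ℓ < 2 ^ suc t →
                   let Ω = labellings ℓ α k in
                   (64 + t) * length Ω ≤ (64 + t) * count explorable? Ω + 256 * length Ω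
explorable-count ℓ α k t 2n≤α 3nt≤k n<2^[1+t] = *-cancelˡ-≤ T {{m^n≢0 α k}} (*-cancelˡ-≤ (65 ^ t) {{m^n≢0 65 t}} (begin
    65 ^ t * (T * (s * ∣Ω∣))
      ≡⟨ swap₁ (65 ^ t) T s ∣Ω∣ ⟩
    65 ^ t * s * (T * ∣Ω∣)
      ≤⟨ *-monoʳ-≤ (65 ^ t * s) (failure-bound {b} {c} {ℓ} k b+c≡α blocks≤α) ⟩
    65 ^ t * s * (T * E + ℓ * (2 * c ^ k) * ∣Ω∣)
      ≡⟨ swap₂ (65 ^ t) T s E ℓ (c ^ k) ∣Ω∣ ⟩
    65 ^ t * (T * (s * E)) + 2 * ℓ * s * ∣Ω∣ * (65 ^ t * c ^ k)
      ≤⟨ +-monoʳ-≤ (65 ^ t * (T * (s * E))) (*-monoʳ-≤ (2 * ℓ * s * ∣Ω∣) (decay {b} {c} {α} {ℓ} b+c≡α α≤4nb {t} 3nt≤k)) ⟩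
    65 ^ t * (T * (s * E)) + 2 * ℓ * s * ∣Ω∣ * (32 ^ t * T)
      ≤⟨ +-monoʳ-≤ (65 ^ t * (T * (s * E))) (*-monoˡ-≤ (32 ^ t * T) (*-monoˡ-≤ ∣Ω∣ (*-monoˡ-≤ s (*-monoʳ-≤ 2 ℓ≤2^[1+t])))) ⟩
    65 ^ t * (T * (s * E)) + 2 * (2 * 2 ^ t) * s * ∣Ω∣ * (32 ^ t * T)
      ≡⟨ cong (λ x → 65 ^ t * (T * (s * E)) + x) (swap₃ (2 ^ t) (32 ^ t) T s ∣Ω∣) ⟩
    65 ^ t * (T * (s * E)) + 4 * T * ∣Ω∣ * (s * (2 ^ t * 32 ^ t))
      ≡⟨ cong (λ x → 65 ^ t * (T * (s * E)) + 4 * T * ∣Ω∣ * (s * x)) (sym (^-distribʳ-* 2 32 t)) ⟩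
    65 ^ t * (T * (s * E)) + 4 * T * ∣Ω∣ * (s * 64 ^ t)
      ≤⟨ +-monoʳ-≤ (65 ^ t * (T * (s * E))) (*-monoʳ-≤ (4 * T * ∣Ω∣) (bernoulli t)) ⟩
    65 ^ t * (T * (s * E)) + 4 * T * ∣Ω∣ * (64 * 65 ^ t)
      ≡⟨ swap₄ (65 ^ t) T (s * E) ∣Ω∣ ⟩
    65 ^ t * (T * (s * E + 256 * ∣Ω∣)) ∎))
  where
  open ≤-Reasoning
  Ω   = labellings ℓ α k
  ∣Ω∣ = length Ω
  E   = count explorable? Ω
  T   = α ^ k
  s   = 64 + t
  n   = suc ℓ
  b   = α ℕ./ (2 * n)
  c   = α ∸ b
  instance
    α≢0 : NonZero α
    α≢0 = >-nonZero (≤-trans (s≤s z≤n) 2n≤α)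
  b+c≡α : b + c ≡ α
  b+c≡α = m+[n∸m]≡n (m/n≤m α (2 * n))
  blocks≤α : 2 * ℓ * b ≤ α
  blocks≤α = begin
    2 * ℓ * b     ≤⟨ *-monoˡ-≤ b (*-monoʳ-≤ 2 (n≤1+n ℓ)) ⟩
    2 * n * b     ≡⟨ *-comm (2 * n) b ⟩
    b * (2 * n)   ≤⟨ m/n*n≤m α (2 * n) ⟩
    α             ∎
  α≤4nb : α ≤ 4 * n * b
  α≤4nb = begin
    α                             ≡⟨ m≡m%n+[m/n]*n α (2 * n) ⟩
    α ℕ.% (2 * n) + b * (2 * n)     ≤⟨ +-monoˡ-≤ _ (<⇒≤ (m%n<n α (2 * n))) ⟩
    -- From `α ≥ 2n` follows `b ≥ 1`, so a second copy of `b * (2 * n)` absorbs the bound `2 * n` on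
    -- the remainder.
    2 * n + b * (2 * n)           ≤⟨ +-monoˡ-≤ _ (≤-trans (≤-reflexive (sym (*-identityˡ (2 * n)))) (*-monoˡ-≤ (2 * n) (m≥n⇒m/n>0 2n≤α))) ⟩
    b * (2 * n) + b * (2 * n)     ≡⟨ collect b n ⟩
    4 * n * b                     ∎
    where
    collect : ∀ b n → b * (2 * n) + b * (2 * n) ≡ 4 * n * b
    collect = solve-∀
  ℓ≤2^[1+t] : ℓ ≤ 2 * 2 ^ t
  ℓ≤2^[1+t] = ≤-trans (n≤1+n ℓ) (<⇒≤ n<2^[1+t])
  swap₁ : ∀ F T s O → F * (T * (s * O)) ≡ F * s * (T * O)
  swap₁ = solve-∀
  swap₂ : ∀ F T s E l C O → F * s * (T * E + l * (2 * C) * O) ≡ F * (T * (s * E)) + 2 * l * s * O * (F * C)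
  swap₂ = solve-∀
  swap₃ : ∀ P Q T s O → 2 * (2 * P) * s * O * (Q * T) ≡ 4 * T * O * (s * (P * Q))
  swap₃ = solve-∀
  swap₄ : ∀ F T X O → F * (T * X) + 4 * T * O * (64 * F) ≡ F * (T * (X + 256 * O))
  swap₄ = solve-∀

-- For the number `D = Ω - E` of failures, `257 q D ≤ s D ≤ 256 Ω < 257 Ω`. Taking 257 instead of
-- 256 makes the result strict.
narrow-gap : ∀ {s E Ω} q → 257 * q ≤ s → E ≤ Ω → 0 < Ω → s * Ω ≤ s * E + 256 * Ω → q * Ω < q * E + Ω
narrow-gap {s} {E} {Ω} q 257q≤s E≤Ω 0<Ω sΩ≤ with m≤n⇒∃[o]m+o≡n E≤Ω
... | D , refl = begin-strict
  q * (E + D)       ≡⟨ *-distribˡ-+ q E D ⟩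
  q * E + q * D     <⟨ +-monoʳ-< (q * E) (*-cancelˡ-< 257 (q * D) Ω qD<Ω) ⟩
  q * E + Ω         ∎
  where
  open ≤-Reasoning
  qD<Ω : 257 * (q * D) < 257 * Ω
  qD<Ω = begin-strict
    257 * (q * D)   ≡⟨ sym (*-assoc 257 q D) ⟩
    257 * q * D     ≤⟨ *-monoˡ-≤ D 257q≤s ⟩
    s * D           ≤⟨ +-cancelˡ-≤ (s * E) (s * D) (256 * Ω) (subst (_≤ s * E + 256 * Ω) (*-distribˡ-+ s E D) sΩ≤) ⟩
    256 * Ω         <⟨ m<n+m (256 * Ω) 0<Ω ⟩
    257 * Ω         ∎

theorem7 : (α k : ℕ → ℕ) →
    (∀ n → 2 * n ≤ α n) →
    (∀ n → fromℕ (k n) ≥ fromℕ (6 * n) ·ln n) →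
    (λ n → ℙ-explorable n (α n) (k n)) ⟶ 1ℚ
theorem7 α k 2n≤α k≥6nlnn ε 0<ε = 2 ^ t₀ , close
  where
  q  = ℚ.↧ₙ ε
  -- Chosen so that `t ≥ t₀` yields the bound `257 * q ≤ 64 + t` required by `narrow-gap`.
  t₀ = 257 * q
  2≤t₀ : 2 ≤ t₀
  2≤t₀ = ≤-trans (s≤s (s≤s z≤n)) (*-monoʳ-≤ 257 (s≤s z≤n))
  close : ∀ n → 2 ^ t₀ ≤ n → ℚ.∣ ℙ-explorable n (α n) (k n) ℚ.- 1ℚ ∣ ℚ.< ε
  close zero    2^t₀≤n = contradiction 2^t₀≤n (<⇒≱ (m^n>0 2 t₀))
  close (suc ℓ) 2^t₀≤n with binary-log ℓ
  ... | t , 2^t≤n , n<2^[1+t] = ratio-near-1 ε 0<ε E≤∣Ω∣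
    (narrow-gap q (≤-trans t₀≤t (m≤n+m t 64)) E≤∣Ω∣ 0<∣Ω∣
      (explorable-count ℓ (α n) (k n) t (2n≤α n) (log-bound {t} (≤-trans 2≤t₀ t₀≤t) 2^t≤n (k≥6nlnn n)) n<2^[1+t]))
    where
    n = suc ℓ
    Ω = labellings ℓ (α n) (k n)
    E≤∣Ω∣ : count explorable? Ω ≤ length Ω
    E≤∣Ω∣ = length-filter explorable? Ω
    t₀≤t : t₀ ≤ t
    -- Otherwise `n < 2 ^ suc t ≤ 2 ^ t₀ ≤ n`.
    t₀≤t = ≮⇒≥ λ t<t₀ → <⇒≱ n<2^[1+t] (≤-trans (^-monoʳ-≤ 2 t<t₀) 2^t₀≤n)
    0<∣Ω∣ : 0 < length Ω
    0<∣Ω∣ = subst (0 <_) (sym ∣Ω∣≡) (m^n>0 (α n ^ k n) {{m^n≢0 (α n) (k n) {{>-nonZero (≤-trans (s≤s z≤n) (2n≤α n))}}}} ℓ)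
      where
      ∣Ω∣≡ : length Ω ≡ (α n ^ k n) ^ ℓ
      ∣Ω∣≡ = trans (length-vectors (vectors (allFin (α n)) (k n)) ℓ) (cong (_^ ℓ) (length-rows (α n) (k n)))
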